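{- Let $L$ be the first-order language with equality and one binary relation symbol $R$, and let $L^{(d)}$ be the first-order language with equality and one binary relation symbol $S$ instead of $R$. Let $A_c$ be the $L$-sentence $$(\forall X)(\exists! Y)(\forall a)\bigl(a\,R\,X \leftrightarrow \neg(a\,R\,Y)\bigr),$$ and write $X^d$ for the unique $Y$ associated with $X$. Let $\Gamma$ be an $L$-theory that includes the axiom $A_c$, and let $\Phi$ be an $L$-sentence. For an $L$-formula $\Psi$, let $\Psi^{(d)}$ be the $L^{(d)}$-formula obtained from $\Psi$ by replacing every occurrence of $R$ by $S$, and let $\Gamma^{(d)}=\{\Psi^{(d)} : \Psi\in\Gamma\}$. Then: (1) $\Gamma\vdash_L \Phi$ if and only if $\Gamma^{(d)}\vdash_{L^{(d)}}\Phi^{(d)}$. (2) If $M$ is an $L$-model of $\Gamma$, let $M^{(d)}$ be the $L^{(d)}$-structure with the same underlying set as $M$ in which $S$ is interpreted by: for all $A,B\in M$, $A\,S^{M^{(d)}}B$ if and only if $A^d\,R^M\,B^d$, where $X^d$ denotes the complement of $X$ computed in $M$. Then the map $X\mapsto X^d$ is an isomorphism between $M$ and $M^{(d)}$ (with $R$ in $M$ corresponding to $S$ in $M^{(d)}$).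
   Context: $\vdash_L$ and $\vdash_{L^{(d)}}$ denote ordinary first-order provability (with equality) in the respective languages. All variables range over the whole domain of a structure. In a model $M$ of $A_c$, for each $X\in M$ the complement $X^d$ is the unique element of $M$ such that for all $a\in M$: $a\,R^M X$ if and only if not $a\,R^M X^d$. That a map $f:M\to M^{(d)}$ is an isomorphism (with $R$ corresponding to $S$) means that $f$ is a bijection and, for all $A,B\in M$, $A\,R^M B$ if and only if $f(A)\,S^{M^{(d)}}f(B)$. The relation symbol $S$ is thought of as the dual of $R$, defined by $A\,S\,B\leftrightarrow A^d\,R\,B^d$. -}

module Defs where

open import Level using (Level; _⊔_) renaming (suc to lsuc)
open import Data.Empty using () renaming (⊥-elim to ⊥₀-elim)
open import Data.Empty.Polymorphic using (⊥; ⊥-elim)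
open import Data.Fin.Base using (Fin; zero; suc; lift)
open import Data.List.Base as List using (List; []; _∷_)
open import Data.List.Membership.Propositional using () renaming (_∈_ to _∈ˡ_)
open import Data.Nat.Base using (ℕ; suc)
open import Data.Product.Base using (∃-syntax; _×_; _,_; proj₁; proj₂)
open import Data.Product using (∃!)
open import Data.Sum.Base using (_⊎_)
open import Data.Vec.Base as Vec using (Vec; []; _∷_; lookup)
open import Function.Bundles using (_⇔_; mk⇔; Equivalence)
open import Function.Definitions using (Bijective)
open import Relation.Binary.PropositionalEquality using (_≡_; refl; sym)
open import Relation.Nullary.Negation using (¬_)
open import Relation.Unary using (Pred; _∈_)

------------------------------------------------------------------------
-- First-order logic with equality over a relational language

-- The relation symbols, indexed by arity.
Language : Set₁
Language = ℕ → Set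

-- Formulas whose free variables are among n variables (de Bruijn indices).
-- There are no function symbols, so variables are the only terms.

infix  9 _≐_
infixr 8 _∧̇_
infixr 7 _∨̇_
infixr 6 _⇒̇_
infix  5 _⇔̇_

data Formula (𝓛 : Language) (n : ℕ) : Set where
  rel  : ∀ {k} → 𝓛 k → Vec (Fin n) k → Formula 𝓛 n
  _≐_  : Fin n → Fin n → Formula 𝓛 n
  ⊥̇    : Formula 𝓛 n
  _⇒̇_  : Formula 𝓛 n → Formula 𝓛 n → Formula 𝓛 n
  _∧̇_  : Formula 𝓛 n → Formula 𝓛 n → Formula 𝓛 n
  _∨̇_  : Formula 𝓛 n → Formula 𝓛 n → Formula 𝓛 n
  ∀̇_   : Formula 𝓛 (suc n) → Formula 𝓛 n
  ∃̇_   : Formula 𝓛 (suc n) → Formula 𝓛 n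

Sentence : Language → Set
Sentence 𝓛 = Formula 𝓛 0

Theory : Language → (g : Level) → Set (lsuc g)
Theory 𝓛 g = Pred (Sentence 𝓛) g

rename : ∀ {𝓛 m n} → (Fin m → Fin n) → Formula 𝓛 m → Formula 𝓛 n
rename σ (rel P xs) = rel P (Vec.map σ xs)
rename σ (x ≐ y)    = σ x ≐ σ y
rename σ ⊥̇          = ⊥̇
rename σ (φ ⇒̇ ψ)    = rename σ φ ⇒̇ rename σ ψ
rename σ (φ ∧̇ ψ)    = rename σ φ ∧̇ rename σ ψ
rename σ (φ ∨̇ ψ)    = rename σ φ ∨̇ rename σ ψ
rename σ (∀̇ φ)      = ∀̇ rename (lift 1 σ) φ
rename σ (∃̇ φ)      = ∃̇ rename (lift 1 σ) φ

weaken : ∀ {𝓛 n} → Formula 𝓛 n → Formula 𝓛 (suc n)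
weaken = rename suc

embed : ∀ {𝓛 n} → Sentence 𝓛 → Formula 𝓛 n
embed = rename λ ()

instantiate : ∀ {n} → Fin n → Fin (suc n) → Fin n
instantiate x zero    = x
instantiate x (suc y) = y

_[_] : ∀ {𝓛 n} → Formula 𝓛 (suc n) → Fin n → Formula 𝓛 n
φ [ x ] = rename (instantiate x) φ

¬̇_ : ∀ {𝓛 n} → Formula 𝓛 n → Formula 𝓛 n
¬̇ φ = φ ⇒̇ ⊥̇

_⇔̇_ : ∀ {𝓛 n} → Formula 𝓛 n → Formula 𝓛 n → Formula 𝓛 n
φ ⇔̇ ψ = (φ ⇒̇ ψ) ∧̇ (ψ ⇒̇ φ)

-- ∃x (φ(x) ∧ ∀y (φ(y) → y = x)): under the two binders y is index 0 and
-- x is index 1, so φ(y) leaves index 0 alone and shifts all others.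
∃!̇_ : ∀ {𝓛 n} → Formula 𝓛 (suc n) → Formula 𝓛 n
∃!̇ φ = ∃̇ (φ ∧̇ ∀̇ (rename (lift 1 suc) φ ⇒̇ zero ≐ suc zero))

-- Classical natural deduction: Γ ∣ Δ ⊢ φ says that φ is derivable from
-- the axioms Γ (sentences) and the open assumptions Δ.

infix 4 _∣_⊢_ _⊢_

data _∣_⊢_ {𝓛 : Language} {g : Level} (Γ : Theory 𝓛 g) {n : ℕ}
           (Δ : List (Formula 𝓛 n)) : Formula 𝓛 n → Set g where
  axiom  : ∀ {φ} → φ ∈ Γ → Γ ∣ Δ ⊢ embed φ
  assume : ∀ {φ} → φ ∈ˡ Δ → Γ ∣ Δ ⊢ φ

  ⇒-intro : ∀ {φ ψ} → Γ ∣ φ ∷ Δ ⊢ ψ → Γ ∣ Δ ⊢ φ ⇒̇ ψ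
  ⇒-elim  : ∀ {φ ψ} → Γ ∣ Δ ⊢ φ ⇒̇ ψ → Γ ∣ Δ ⊢ φ → Γ ∣ Δ ⊢ ψ

  ∧-intro  : ∀ {φ ψ} → Γ ∣ Δ ⊢ φ → Γ ∣ Δ ⊢ ψ → Γ ∣ Δ ⊢ φ ∧̇ ψ
  ∧-elimˡ  : ∀ {φ ψ} → Γ ∣ Δ ⊢ φ ∧̇ ψ → Γ ∣ Δ ⊢ φ
  ∧-elimʳ  : ∀ {φ ψ} → Γ ∣ Δ ⊢ φ ∧̇ ψ → Γ ∣ Δ ⊢ ψ

  ∨-introˡ : ∀ {φ ψ} → Γ ∣ Δ ⊢ φ → Γ ∣ Δ ⊢ φ ∨̇ ψ
  ∨-introʳ : ∀ {φ ψ} → Γ ∣ Δ ⊢ ψ → Γ ∣ Δ ⊢ φ ∨̇ ψ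
  ∨-elim   : ∀ {φ ψ χ} → Γ ∣ Δ ⊢ φ ∨̇ ψ →
             Γ ∣ φ ∷ Δ ⊢ χ → Γ ∣ ψ ∷ Δ ⊢ χ → Γ ∣ Δ ⊢ χ

  reductio : ∀ {φ} → Γ ∣ ¬̇ φ ∷ Δ ⊢ ⊥̇ → Γ ∣ Δ ⊢ φ

  ∀-intro : ∀ {φ} → Γ ∣ List.map weaken Δ ⊢ φ → Γ ∣ Δ ⊢ ∀̇ φ
  ∀-elim  : ∀ {φ} → Γ ∣ Δ ⊢ ∀̇ φ → (x : Fin n) → Γ ∣ Δ ⊢ φ [ x ]

  ∃-intro : ∀ {φ} (x : Fin n) → Γ ∣ Δ ⊢ φ [ x ] → Γ ∣ Δ ⊢ ∃̇ φ
  ∃-elim  : ∀ {φ ψ} → Γ ∣ Δ ⊢ ∃̇ φ →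
            Γ ∣ φ ∷ List.map weaken Δ ⊢ weaken ψ → Γ ∣ Δ ⊢ ψ

  ≐-refl  : ∀ {x} → Γ ∣ Δ ⊢ x ≐ x
  ≐-subst : ∀ φ {x y} → Γ ∣ Δ ⊢ x ≐ y → Γ ∣ Δ ⊢ φ [ x ] → Γ ∣ Δ ⊢ φ [ y ]

  -- Domains are non-empty.  This has to be a rule of its own because no
  -- variable is available for ∃-intro and ∀-elim when n = 0.
  nonempty : Γ ∣ Δ ⊢ ∃̇ (zero ≐ zero)

_⊢_ : ∀ {𝓛 g} → Theory 𝓛 g → Sentence 𝓛 → Set g
Γ ⊢ φ = Γ ∣ [] ⊢ φ

-- Equality is interpreted as identity, and satisfaction is Tarski's clauses
-- read in the metatheory; in particular ∃̇ and ∨̇ are interpreted by witnesses.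
record Structure (𝓛 : Language) (ℓ : Level) : Set (lsuc ℓ) where
  field
    Carrier : Set ℓ
    point   : Carrier
    interp  : ∀ {k} → 𝓛 k → Vec Carrier k → Set ℓ

open Structure public using (Carrier; point; interp)

module _ {𝓛 : Language} {ℓ : Level} where

  ⟦_⟧ : ∀ {n} → Formula 𝓛 n → (M : Structure 𝓛 ℓ) → Vec (Carrier M) n → Set ℓ
  ⟦ rel P xs ⟧ M ρ = interp M P (Vec.map (lookup ρ) xs)
  ⟦ x ≐ y    ⟧ M ρ = lookup ρ x ≡ lookup ρ y
  ⟦ ⊥̇        ⟧ M ρ = ⊥
  ⟦ φ ⇒̇ ψ    ⟧ M ρ = ⟦ φ ⟧ M ρ → ⟦ ψ ⟧ M ρ
  ⟦ φ ∧̇ ψ    ⟧ M ρ = ⟦ φ ⟧ M ρ × ⟦ ψ ⟧ M ρ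
  ⟦ φ ∨̇ ψ    ⟧ M ρ = ⟦ φ ⟧ M ρ ⊎ ⟦ ψ ⟧ M ρ
  ⟦ ∀̇ φ      ⟧ M ρ = (a : Carrier M) → ⟦ φ ⟧ M (a ∷ ρ)
  ⟦ ∃̇ φ      ⟧ M ρ = ∃[ a ] ⟦ φ ⟧ M (a ∷ ρ)

  infix 4 _⊨_ _⊨ᵀ_

  _⊨_ : Structure 𝓛 ℓ → Sentence 𝓛 → Set ℓ
  M ⊨ φ = ⟦ φ ⟧ M []

  _⊨ᵀ_ : ∀ {g} → Structure 𝓛 ℓ → Theory 𝓛 g → Set (g ⊔ ℓ)
  M ⊨ᵀ Γ = ∀ φ → φ ∈ Γ → M ⊨ φ

------------------------------------------------------------------------
-- The languages L and L⁽ᵈ⁾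

data L : Language where
  R : L 2

data Lᵈ : Language where
  S : Lᵈ 2

infix 20 _ᵈ _ᵈᵀ

_ᵈ : ∀ {n} → Formula L n → Formula Lᵈ n
rel R xs ᵈ = rel S xs
(x ≐ y)  ᵈ = x ≐ y
⊥̇        ᵈ = ⊥̇
(φ ⇒̇ ψ)  ᵈ = φ ᵈ ⇒̇ ψ ᵈ
(φ ∧̇ ψ)  ᵈ = φ ᵈ ∧̇ ψ ᵈ
(φ ∨̇ ψ)  ᵈ = φ ᵈ ∨̇ ψ ᵈ
(∀̇ φ)    ᵈ = ∀̇ (φ ᵈ)
(∃̇ φ)    ᵈ = ∃̇ (φ ᵈ)

_ᵈᵀ : ∀ {g} → Theory L g → Theory Lᵈ g
(Γ ᵈᵀ) ψ = ∃[ φ ] (φ ∈ Γ × φ ᵈ ≡ ψ)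

-- (∀X)(∃!Y)(∀a)(a R X ↔ ¬ (a R Y)); inside the three quantifiers a, Y, X
-- are the indices 0, 1, 2.
A-c : Sentence L
A-c = ∀̇ ∃!̇ ∀̇ (rel R (a ∷ X ∷ []) ⇔̇ ¬̇ rel R (a ∷ Y ∷ []))
  where
  a Y X : Fin 3
  a = zero
  Y = suc zero
  X = suc (suc zero)

------------------------------------------------------------------------
-- Complements, the dual structure, isomorphisms

module _ {ℓ : Level} where

  Rel : (M : Structure L ℓ) → Carrier M → Carrier M → Set ℓ
  Rel M A B = interp M R (A ∷ B ∷ [])

  Relᵈ : (N : Structure Lᵈ ℓ) → Carrier N → Carrier N → Set ℓ
  Relᵈ N A B = interp N S (A ∷ B ∷ [])

  IsComplement : (M : Structure L ℓ) → Carrier M → Carrier M → Set ℓ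
  IsComplement M X Y = ∀ a → Rel M a X ⇔ (¬ Rel M a Y)

  module _ (M : Structure L ℓ) (M⊨A-c : M ⊨ A-c) where

    complement! : ∀ X → ∃! _≡_ (IsComplement M X)
    complement! X with M⊨A-c X
    ... | Y , c , unique =
      Y ,
      (λ a → mk⇔ (λ aRX aRY → ⊥-elim (proj₁ (c a) aRX aRY))
                 (λ ¬aRY → proj₂ (c a) λ aRY → ⊥₀-elim (¬aRY aRY))) ,
      λ {Z} d → sym (unique Z λ a →
        (λ aRX aRZ → ⊥₀-elim (Equivalence.to (d a) aRX aRZ)) ,
        (λ ¬aRZ → Equivalence.from (d a) λ aRZ → ⊥-elim (¬aRZ aRZ)))

    complement : Carrier M → Carrier M
    complement X = proj₁ (complement! X)

    dualStructure : Structure Lᵈ ℓ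
    dualStructure = record
      { Carrier = Carrier M
      ; point   = point M
      ; interp  = λ { S (A ∷ B ∷ []) → Rel M (complement A) (complement B) }
      }

  record IsIsomorphism (M : Structure L ℓ) (N : Structure Lᵈ ℓ)
                       (f : Carrier M → Carrier N) : Set ℓ where
    field
      bijective : Bijective _≡_ _≡_ f
      preserves : ∀ A B → Rel M A B ⇔ Relᵈ N (f A) (f B)

-- The two languages differ only in the name of their relation symbol, so renaming it carries
-- derivations to derivations in both directions.  In a model of A_c every instance of a R X is
-- equivalent to a negation, hence stable under double negation; this makes the relation "Y is the
-- complement of X" symmetric, so the complement is an involution, and an involution is a bijection.
module Submission where

open import Defs
open import Level using (Level)
open import Data.Fin.Base using (Fin; lift)
open import Data.List.Base as List using (List; _∷_)
open import Data.List.Membership.Propositional.Properties using (∈-map⁺)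
open import Data.List.Properties using (map-cong; map-∘)
open import Data.Product using (_×_; _,_; proj₁; proj₂)
open import Function.Base using (_∘_)
open import Function.Bundles using (_⇔_; mk⇔; Equivalence)
open import Function.Consequences.Propositional using (inverseᵇ⇒bijective)
open import Relation.Binary.PropositionalEquality
  using (_≡_; refl; sym; trans; cong; cong₂; subst; subst₂)
open import Relation.Nullary.Negation using (¬_)
open import Relation.Unary using (_∈_)

-- `_ᵈ` only goes from `L` to `Lᵈ`. Allowing an arbitrary map of symbols lets a single induction on
-- derivations serve both directions of the equivalence.
mapSymbols : ∀ {𝓛 𝓛′ n} → (∀ {k} → 𝓛 k → 𝓛′ k) → Formula 𝓛 n → Formula 𝓛′ n
mapSymbols τ (rel P xs) = rel (τ P) xs
mapSymbols τ (x ≐ y)    = x ≐ y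
mapSymbols τ ⊥̇          = ⊥̇
mapSymbols τ (φ ⇒̇ ψ)    = mapSymbols τ φ ⇒̇ mapSymbols τ ψ
mapSymbols τ (φ ∧̇ ψ)    = mapSymbols τ φ ∧̇ mapSymbols τ ψ
mapSymbols τ (φ ∨̇ ψ)    = mapSymbols τ φ ∨̇ mapSymbols τ ψ
mapSymbols τ (∀̇ φ)      = ∀̇ mapSymbols τ φ
mapSymbols τ (∃̇ φ)      = ∃̇ mapSymbols τ φ

module _ {𝓛 𝓛′ : Language} (τ : ∀ {k} → 𝓛 k → 𝓛′ k) where

  -- `embed`, `weaken` and instantiation are all instances of `rename`, so this one commutation
  -- handles every rule whose formulas are renamed.
  mapSymbols-rename : ∀ {m n} (σ : Fin m → Fin n) (φ : Formula 𝓛 m) →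
    mapSymbols τ (rename σ φ) ≡ rename σ (mapSymbols τ φ)
  mapSymbols-rename σ (rel P xs) = refl
  mapSymbols-rename σ (x ≐ y)    = refl
  mapSymbols-rename σ ⊥̇          = refl
  mapSymbols-rename σ (φ ⇒̇ ψ)    = cong₂ _⇒̇_ (mapSymbols-rename σ φ) (mapSymbols-rename σ ψ)
  mapSymbols-rename σ (φ ∧̇ ψ)    = cong₂ _∧̇_ (mapSymbols-rename σ φ) (mapSymbols-rename σ ψ)
  mapSymbols-rename σ (φ ∨̇ ψ)    = cong₂ _∨̇_ (mapSymbols-rename σ φ) (mapSymbols-rename σ ψ)
  mapSymbols-rename σ (∀̇ φ)      = cong ∀̇_ (mapSymbols-rename (lift 1 σ) φ)
  mapSymbols-rename σ (∃̇ φ)      = cong ∃̇_ (mapSymbols-rename (lift 1 σ) φ)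

  map-mapSymbols-weaken : ∀ {n} (Δ : List (Formula 𝓛 n)) →
    List.map (mapSymbols τ) (List.map weaken Δ) ≡ List.map weaken (List.map (mapSymbols τ) Δ)
  map-mapSymbols-weaken Δ =
    trans (sym (map-∘ Δ)) (trans (map-cong (mapSymbols-rename _) Δ) (map-∘ Δ))

  module _ {g g′ : Level} {Γ : Theory 𝓛 g} {Γ′ : Theory 𝓛′ g′}
           (Γ⇒Γ′ : ∀ {φ} → φ ∈ Γ → mapSymbols τ φ ∈ Γ′) where

    mapSymbols-⊢ : ∀ {n Δ} {φ : Formula 𝓛 n} →
      Γ ∣ Δ ⊢ φ → Γ′ ∣ List.map (mapSymbols τ) Δ ⊢ mapSymbols τ φ
    mapSymbols-⊢ (axiom {φ} p)    = subst (Γ′ ∣ _ ⊢_) (sym (mapSymbols-rename _ φ)) (axiom (Γ⇒Γ′ p))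
    mapSymbols-⊢ (assume p)       = assume (∈-map⁺ (mapSymbols τ) p)
    mapSymbols-⊢ (⇒-intro d)      = ⇒-intro (mapSymbols-⊢ d)
    mapSymbols-⊢ (⇒-elim d e)     = ⇒-elim (mapSymbols-⊢ d) (mapSymbols-⊢ e)
    mapSymbols-⊢ (∧-intro d e)    = ∧-intro (mapSymbols-⊢ d) (mapSymbols-⊢ e)
    mapSymbols-⊢ (∧-elimˡ d)      = ∧-elimˡ (mapSymbols-⊢ d)
    mapSymbols-⊢ (∧-elimʳ d)      = ∧-elimʳ (mapSymbols-⊢ d)
    mapSymbols-⊢ (∨-introˡ d)     = ∨-introˡ (mapSymbols-⊢ d)
    mapSymbols-⊢ (∨-introʳ d)     = ∨-introʳ (mapSymbols-⊢ d)
    mapSymbols-⊢ (∨-elim d e f)   = ∨-elim (mapSymbols-⊢ d) (mapSymbols-⊢ e) (mapSymbols-⊢ f)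
    mapSymbols-⊢ (reductio d)     = reductio (mapSymbols-⊢ d)
    -- Going under the binder weakens all open assumptions, so here the context has to be
    -- transported and not only the conclusion.
    mapSymbols-⊢ {Δ = Δ} (∀-intro d) =
      ∀-intro (subst (Γ′ ∣_⊢ _) (map-mapSymbols-weaken Δ) (mapSymbols-⊢ d))
    mapSymbols-⊢ (∀-elim {φ} d x) =
      subst (Γ′ ∣ _ ⊢_) (sym (mapSymbols-rename _ φ)) (∀-elim (mapSymbols-⊢ d) x)
    mapSymbols-⊢ (∃-intro {φ} x d) =
      ∃-intro x (subst (Γ′ ∣ _ ⊢_) (mapSymbols-rename _ φ) (mapSymbols-⊢ d))
    mapSymbols-⊢ {Δ = Δ} (∃-elim {φ} {ψ} d e) =
      ∃-elim (mapSymbols-⊢ d)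
        (subst₂ (Γ′ ∣_⊢_) (cong (mapSymbols τ φ ∷_) (map-mapSymbols-weaken Δ))
          (mapSymbols-rename _ ψ) (mapSymbols-⊢ e))
    mapSymbols-⊢ ≐-refl           = ≐-refl
    mapSymbols-⊢ (≐-subst φ d e)  =
      subst (Γ′ ∣ _ ⊢_) (sym (mapSymbols-rename _ φ))
        (≐-subst (mapSymbols τ φ) (mapSymbols-⊢ d)
          (subst (Γ′ ∣ _ ⊢_) (mapSymbols-rename _ φ) (mapSymbols-⊢ e)))
    mapSymbols-⊢ nonempty         = nonempty

R↦S : ∀ {k} → L k → Lᵈ k
R↦S R = S

S↦R : ∀ {k} → Lᵈ k → L k
S↦R S = R

mapSymbols-R↦S : ∀ {n} (φ : Formula L n) → mapSymbols R↦S φ ≡ φ ᵈ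
mapSymbols-R↦S (rel R xs) = refl
mapSymbols-R↦S (x ≐ y)    = refl
mapSymbols-R↦S ⊥̇          = refl
mapSymbols-R↦S (φ ⇒̇ ψ)    = cong₂ _⇒̇_ (mapSymbols-R↦S φ) (mapSymbols-R↦S ψ)
mapSymbols-R↦S (φ ∧̇ ψ)    = cong₂ _∧̇_ (mapSymbols-R↦S φ) (mapSymbols-R↦S ψ)
mapSymbols-R↦S (φ ∨̇ ψ)    = cong₂ _∨̇_ (mapSymbols-R↦S φ) (mapSymbols-R↦S ψ)
mapSymbols-R↦S (∀̇ φ)      = cong ∀̇_ (mapSymbols-R↦S φ)
mapSymbols-R↦S (∃̇ φ)      = cong ∃̇_ (mapSymbols-R↦S φ)

mapSymbols-S↦R : ∀ {n} (φ : Formula L n) → mapSymbols S↦R (φ ᵈ) ≡ φ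
mapSymbols-S↦R (rel R xs) = refl
mapSymbols-S↦R (x ≐ y)    = refl
mapSymbols-S↦R ⊥̇          = refl
mapSymbols-S↦R (φ ⇒̇ ψ)    = cong₂ _⇒̇_ (mapSymbols-S↦R φ) (mapSymbols-S↦R ψ)
mapSymbols-S↦R (φ ∧̇ ψ)    = cong₂ _∧̇_ (mapSymbols-S↦R φ) (mapSymbols-S↦R ψ)
mapSymbols-S↦R (φ ∨̇ ψ)    = cong₂ _∨̇_ (mapSymbols-S↦R φ) (mapSymbols-S↦R ψ)
mapSymbols-S↦R (∀̇ φ)      = cong ∀̇_ (mapSymbols-S↦R φ)
mapSymbols-S↦R (∃̇ φ)      = cong ∃̇_ (mapSymbols-S↦R φ)

⊢⇔⊢ᵈ : ∀ {g} (Γ : Theory L g) (φ : Sentence L) → Γ ⊢ φ ⇔ Γ ᵈᵀ ⊢ φ ᵈ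
⊢⇔⊢ᵈ Γ φ = mk⇔
  (subst (Γ ᵈᵀ ⊢_) (mapSymbols-R↦S φ) ∘
    mapSymbols-⊢ R↦S λ {ψ} ψ∈Γ → ψ , ψ∈Γ , sym (mapSymbols-R↦S ψ))
  (subst (Γ ⊢_) (mapSymbols-S↦R φ) ∘
    -- A member of `Γ ᵈᵀ` comes with a preimage `ψ` in `Γ`, and translating it back returns `ψ`
    -- itself.
    mapSymbols-⊢ S↦R λ { (ψ , ψ∈Γ , refl) → subst (_∈ Γ) (sym (mapSymbols-S↦R ψ)) ψ∈Γ })

module _ {ℓ : Level} (M : Structure L ℓ) (M⊨A-c : M ⊨ A-c) where

  private
    _ᶜ : Carrier M → Carrier M
    _ᶜ = complement M M⊨A-c

    isComplement : ∀ X → IsComplement M X (X ᶜ)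
    isComplement X = proj₁ (proj₂ (complement! M M⊨A-c X))

  -- Satisfaction is read constructively, so this has to come from the axiom: `a R X` is equivalent
  -- to the negation of `a R (X ᶜ)`, and a triple negation collapses to a single one.
  Rel-stable : ∀ a X → ¬ ¬ Rel M a X → Rel M a X
  Rel-stable a X ¬¬aRX =
    from λ aRXᶜ → ¬¬aRX λ aRX → to aRX aRXᶜ
    where open Equivalence (isComplement X a)

  IsComplement-sym : ∀ {X Y} → IsComplement M X Y → IsComplement M Y X
  IsComplement-sym {X} {Y} c a = mk⇔
    (λ aRY aRX → to aRX aRY)
    -- If `a R Y` failed, `from` would give `a R X`. This refutes only the negation of `a R Y`;
    -- stability, obtained from the complement of `Y` itself, does the rest.
    (λ ¬aRX → Rel-stable a Y (¬aRX ∘ from))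
    where open Equivalence (c a)

  -- By symmetry `X` is a complement of `X ᶜ`, and uniqueness identifies it with the chosen one.
  complement-involutive : ∀ X → (X ᶜ) ᶜ ≡ X
  complement-involutive X =
    proj₂ (proj₂ (complement! M M⊨A-c (X ᶜ))) (IsComplement-sym (isComplement X))

  complement-isIsomorphism : IsIsomorphism M (dualStructure M M⊨A-c) (complement M M⊨A-c)
  complement-isIsomorphism = record
    { bijective = inverseᵇ⇒bijective {f⁻¹ = _ᶜ}
        ( (λ { refl → complement-involutive _ })
        , (λ { refl → complement-involutive _ }))
    -- `S` between `A ᶜ` and `B ᶜ` unfolds to `R` between the double complements, which are `A` and
    -- `B` again.
    ; preserves = λ A B → mk⇔
        (subst₂ (Rel M) (sym (complement-involutive A)) (sym (complement-involutive B)))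
        (subst₂ (Rel M) (complement-involutive A) (complement-involutive B))
    }

theorem2p1 : ∀ {g ℓ : Level} (Γ : Theory L g) (A-c∈Γ : A-c ∈ Γ) (Φ : Sentence L) →
    (Γ ⊢ Φ ⇔ Γ ᵈᵀ ⊢ Φ ᵈ)
    × ((M : Structure L ℓ) (M⊨Γ : M ⊨ᵀ Γ) →
    IsIsomorphism M (dualStructure M (M⊨Γ A-c A-c∈Γ)) (complement M (M⊨Γ A-c A-c∈Γ)))
theorem2p1 Γ A-c∈Γ Φ = ⊢⇔⊢ᵈ Γ Φ , λ M M⊨Γ → complement-isIsomorphism M (M⊨Γ A-c A-c∈Γ)
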